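{- Let $q$ be a prime power. If $q$ is odd, there exists a $(q+1,\,q^2-q)$-harc in $\Pi_2(q^2)$. If $q$ is even, there exists a maximal $(q+2,\,q^2-q)$-harc in $\Pi_2(q^2)$.
   Context: $\Pi_2(n)$ denotes the desarguesian projective plane over $GF(n)$. A $k$-arc in $\Pi_2(n)$ is a set of $k$ points no three of which are collinear. Let $\Psi$ be a line of $\Pi_2(n)$, $\mathcal{K}_1$ a set of $k_1$ points in $\Pi_2(n)\setminus\Psi$ and $\mathcal{K}_2$ a set of $k_2$ points in $\Psi$. The set $\mathcal{K}=\mathcal{K}_1\cup\mathcal{K}_2$ is a $(k_1,k_2)$-harc (hierarchical arc) in $\Pi_2(n)$ if: (a) $\mathcal{K}_1$ is a $k_1$-arc in $\Pi_2(n)$; (b) $\mathcal{K}_2$ is a $k_2$-arc in the projective line $\Psi$ (any two of its points are independent, which is automatic); (c) any three points of $\mathcal{K}$ not all contained in $\Psi$ are linearly independent (non-collinear). A $(k_1,k_2)$-harc in $\Pi_2(n)$ is called maximal if it attains the upper bound $k_1+k_2\le n+2$, i.e. if $k_1+k_2=n+2$. -}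

module Defs where

open import Algebra.Apartness.Bundles using (HeytingField; HeytingCommutativeRing)
open import Algebra.Bundles using (CommutativeRing)
import Algebra.Apartness.Properties.HeytingCommutativeRing as HCRProperties
import Algebra.Definitions.RawMonoid as RawMonoidDefs
open import Data.Fin.Base using (Fin)
open import Data.Nat.Base as ℕ using (ℕ)
open import Data.Nat.Primality using (Prime)
open import Data.Product.Base using (∃-syntax; Σ-syntax; _×_; _,_; proj₁)
open import Data.Vec.Functional using (Vector; []; _∷_)
open import Function.Bundles using (Injection; Inverse)
open import Level using (Level; _⊔_; suc)
open import Relation.Binary.Bundles using (Setoid)
open import Relation.Binary.Structures using (IsEquivalence)
open import Relation.Binary.PropositionalEquality.Core using (_≡_)
import Relation.Binary.PropositionalEquality.Properties as ≡
open import Relation.Nullary.Negation.Core using (¬_)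
open import Relation.Unary using (Pred; _∪_)

IsPrimePower : ℕ → Set
IsPrimePower q = ∃[ p ] ∃[ e ] Prime p × 1 ℕ.≤ e × q ≡ p ℕ.^ e

-- GF(n) is unique up to isomorphism, so "the" field GF(n) is rendered as an
-- arbitrary field with exactly n elements.  The enumeration makes _≈_ and _#_
-- decidable, so that x # y is equivalent to ¬ (x ≈ y).
record GaloisField (n : ℕ) (c ℓ₁ ℓ₂ : Level) : Set (suc (c ⊔ ℓ₁ ⊔ ℓ₂)) where
  field
    heytingField : HeytingField c ℓ₁ ℓ₂

  open HeytingField heytingField public

  open HeytingCommutativeRing heytingCommutativeRing public
    using (commutativeRing)

  open CommutativeRing commutativeRing public
    using (+-rawMonoid)

  field
    enumeration : Inverse setoid (≡.setoid (Fin n))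

-- The desarguesian plane over GF(n), in homogeneous coordinates.
module ProjectivePlane {n : ℕ} {c ℓ₁ ℓ₂ : Level} (F : GaloisField n c ℓ₁ ℓ₂) where

  open GaloisField F
  open HCRProperties heytingCommutativeRing
    using (1#0; x#0y#0→xy#0; invertibleˡ⇒#; x-0≈x)
  open RawMonoidDefs +-rawMonoid using (sum)

  LinearlyIndependent : ∀ {m} → Vector (Vector Carrier 3) m → Set (c ⊔ ℓ₁)
  LinearlyIndependent {m} v =
    ∀ (a : Vector Carrier m) →
    (∀ i → sum (λ j → a j * v j i) ≈ 0#) →
    ∀ j → a j ≈ 0#

  NonZeroVector : Set (c ⊔ ℓ₂)
  NonZeroVector = Σ[ v ∈ Vector Carrier 3 ] ∃[ i ] v i # 0#

  Point : Set (c ⊔ ℓ₂)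
  Point = NonZeroVector

  coords : Point → Vector Carrier 3
  coords = proj₁

  infix 4 _∼_ _∈ₗ_

  _∼_ : Point → Point → Set (c ⊔ ℓ₁ ⊔ ℓ₂)
  P ∼ Q = ∃[ a ] a # 0# × (∀ i → coords P i ≈ a * coords Q i)

  ∼-isEquivalence : IsEquivalence _∼_
  ∼-isEquivalence = record
    { refl  = 1# , 1#0 , λ i → sym (*-identityˡ _)
    ; sym   = λ {P} {Q} → ∼-sym P Q
    ; trans = λ (a , a#0 , p) (b , b#0 , q) →
        a * b , x#0y#0→xy#0 a#0 b#0 ,
        λ i → trans (p i) (trans (*-congˡ (q i)) (sym (*-assoc a b _)))
    }
    where
    ∼-sym : ∀ P Q → P ∼ Q → Q ∼ P
    ∼-sym P Q (a , a#0 , p) with #⇒invertible a#0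
    ... | b , b*[a-0]≈1 , _ =
      b ,
      invertibleˡ⇒# (a , trans (*-congˡ (x-0≈x b)) (trans (*-comm a b) ba≈1)) ,
      λ i → sym (trans (*-congˡ (p i))
        (trans (sym (*-assoc b a _)) (trans (*-congʳ ba≈1) (*-identityˡ _))))
      where
      ba≈1 : b * a ≈ 1#
      ba≈1 = trans (*-congˡ (sym (x-0≈x a))) b*[a-0]≈1

  pointSetoid : Setoid (c ⊔ ℓ₂) (c ⊔ ℓ₁ ⊔ ℓ₂)
  pointSetoid = record { isEquivalence = ∼-isEquivalence }

  -- A line is given by the coefficients (up to scalars) of its equation.
  Line : Set (c ⊔ ℓ₂)
  Line = NonZeroVector

  _∈ₗ_ : Point → Line → Set ℓ₁
  P ∈ₗ Ψ = sum (λ i → proj₁ Ψ i * coords P i) ≈ 0#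

  -- A set of exactly k points: k pairwise distinct points.
  PointSet : ℕ → Set (c ⊔ ℓ₁ ⊔ ℓ₂)
  PointSet k = Injection (≡.setoid (Fin k)) pointSetoid

  ⟦_⟧ : ∀ {k} → PointSet k → Pred Point (c ⊔ ℓ₁ ⊔ ℓ₂)
  ⟦ K ⟧ P = ∃[ i ] Injection.to K i ∼ P

  Distinct₃ : Point → Point → Point → Set (c ⊔ ℓ₁ ⊔ ℓ₂)
  Distinct₃ P Q R = ¬ (P ∼ Q) × ¬ (P ∼ R) × ¬ (Q ∼ R)

  Collinear : Point → Point → Point → Set (c ⊔ ℓ₁ ⊔ ℓ₂)
  Collinear P Q R = ∃[ Ψ ] P ∈ₗ Ψ × Q ∈ₗ Ψ × R ∈ₗ Ψ

  IsArc : ∀ {k} → PointSet k → Set (c ⊔ ℓ₁ ⊔ ℓ₂)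
  IsArc K = ∀ P Q R → ⟦ K ⟧ P → ⟦ K ⟧ Q → ⟦ K ⟧ R →
    Distinct₃ P Q R → ¬ Collinear P Q R

  record IsHarc {k₁ k₂ : ℕ} (Ψ : Line) (K₁ : PointSet k₁) (K₂ : PointSet k₂)
      : Set (c ⊔ ℓ₁ ⊔ ℓ₂) where
    field
      K₁-off-Ψ : ∀ P → ⟦ K₁ ⟧ P → ¬ (P ∈ₗ Ψ)
      K₂-on-Ψ  : ∀ P → ⟦ K₂ ⟧ P → P ∈ₗ Ψ
      K₁-arc   : IsArc K₁
      K₂-arc   : ∀ P Q → ⟦ K₂ ⟧ P → ⟦ K₂ ⟧ Q → ¬ (P ∼ Q) →
        LinearlyIndependent (coords P ∷ coords Q ∷ [])
      K-mixed  : ∀ P Q R → let K = ⟦ K₁ ⟧ ∪ ⟦ K₂ ⟧ in K P → K Q → K R →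
        Distinct₃ P Q R → ¬ (P ∈ₗ Ψ × Q ∈ₗ Ψ × R ∈ₗ Ψ) →
        LinearlyIndependent (coords P ∷ coords Q ∷ coords R ∷ [])

  IsMaximalHarc : ∀ {k₁ k₂} → Line → PointSet k₁ → PointSet k₂ → Set (c ⊔ ℓ₁ ⊔ ℓ₂)
  IsMaximalHarc {k₁} {k₂} Ψ K₁ K₂ = IsHarc Ψ K₁ K₂ × k₁ ℕ.+ k₂ ≡ n ℕ.+ 2

  HasHarc : ℕ → ℕ → Set (c ⊔ ℓ₁ ⊔ ℓ₂)
  HasHarc k₁ k₂ = ∃[ Ψ ] Σ[ K₁ ∈ PointSet k₁ ] Σ[ K₂ ∈ PointSet k₂ ] IsHarc Ψ K₁ K₂

  HasMaximalHarc : ℕ → ℕ → Set (c ⊔ ℓ₁ ⊔ ℓ₂)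
  HasMaximalHarc k₁ k₂ =
    ∃[ Ψ ] Σ[ K₁ ∈ PointSet k₁ ] Σ[ K₂ ∈ PointSet k₂ ] IsMaximalHarc Ψ K₁ K₂

{-# OPTIONS --safe #-}
module Submission where

-- Let N be the group of elements x of GF(q²) with x^(q+1) = 1, and let ℓ∞ be
-- the line X₂ = 0.  The harc consists of the conic points (x² , 1 , x) with x
-- in N, off ℓ∞, and of those points of ℓ∞ which lie on no line through two of
-- them.  The line through the points with parameters x and y meets ℓ∞ in
-- (- x y , 1 , 0), and x y lies in N again, so the points (- w , 1 , 0) with w
-- outside N and the point (1 , 0 , 0) are on no such line.  Three conic points
-- are never collinear, by a Vandermonde determinant.
--
-- If q is even, the field has characteristic two, and the nucleus (0 , 0 , 1)
-- can be added off ℓ∞: its determinant with two conic points is (x - y)², and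
-- the line joining it to the point with parameter x meets ℓ∞ in (x² , 1 , 0),
-- which is (- x² , 1 , 0) with x² in N.  All these determinants are collected
-- in the lemma nondegenerate; a nonzero determinant gives both independence and
-- non-collinearity, by Cramer's rule for the matrix and for its transpose.
--
-- It remains to see that N has exactly q + 1 elements, for then the points on
-- ℓ∞ number 1 + q² - (q + 1) = q² - q.  By Fermat's little theorem every
-- element of GF(q²) is a root of
-- X^(q²) - X = (X^(q+1) - 1) (X + X^(q+2) + … + X^(q²-q-1)).
-- The elements of N are roots of the first factor and the others roots of the
-- second, so there are at most q + 1 and at most q² - q - 1 of them.  As there
-- are q² elements in all, both bounds are attained.

open import Defs
open import Data.Product.Base using (_×_)
open import Level using (Level)
open import Relation.Nullary.Negation.Core using (¬_)

open import Algebra.Bundles using (CommutativeRing)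
import Algebra.Properties.CommutativeMonoid.Sum as MonoidSum
import Algebra.Properties.Ring as RingProperties
import Algebra.Properties.Semiring.Exp as Exp
import Algebra.Properties.Semiring.Mult.TCOptimised as Mult
import Algebra.Solver.Ring as RingSolver
open import Algebra.Solver.Ring.AlmostCommutativeRing
  using (_-Raw-AlmostCommutative⟶_; fromCommutativeRing)
open import Data.Fin.Base using (Fin; zero; suc; punchIn)
open import Data.Fin.Patterns using (0F; 1F; 2F)
open import Data.Fin.Permutation using (Permutation′; permutation)
import Data.Fin.Properties as Fin
open import Data.Integer.Base as ℤ using (ℤ; +_; -[1+_]; _⊖_)
import Data.Integer.Properties as ℤ
open import Data.List.Base as List using (List; []; _∷_; length; filter; lookup; tabulate)
open import Data.List.Membership.Propositional.Properties using (∈-lookup)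
import Data.List.Properties as List
open import Data.List.Relation.Unary.All as All using (All; []; _∷_)
import Data.List.Relation.Unary.All.Properties as All
open import Data.List.Relation.Unary.AllPairs using ([]; _∷_)
import Data.List.Relation.Unary.Unique.Setoid as Uniqueness
import Data.List.Relation.Unary.Unique.Setoid.Properties as UniqueProperties
open import Data.Maybe.Base using (Maybe; just; nothing)
open import Data.Nat.Base as ℕ using (ℕ; zero; suc; z≤n; s≤s; nonTrivial⇒n>1)
open import Data.Nat.Divisibility using (_∣_; divides; ∣m⇒∣m*n)
open import Data.Nat.Primality using (prime⇒nonTrivial; prime⇒nonZero)
import Data.Nat.Properties as ℕ
import Data.Nat.Tactic.RingSolver as ℕ-Ring
open import Data.Product.Base using (∃-syntax; _,_; proj₁; proj₂)
open import Data.Sum.Base using (_⊎_; inj₁; inj₂)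
open import Data.Vec.Base as Vec using (Vec; []; _∷_)
import Data.Vec.Functional as Vector
open import Data.Vec.Functional using (Vector)
open import Function.Base using (_∘_)
open import Function.Bundles using (Inverse)
open import Relation.Binary.Bundles using (Setoid)
open import Relation.Binary.Definitions using (Decidable)
open import Relation.Binary.PropositionalEquality.Core as ≡ using (_≡_; _≢_)
open import Relation.Binary.PropositionalEquality.Properties using (module ≡-Reasoning)
import Relation.Binary.Reasoning.Setoid as SetoidReasoning
open import Relation.Nullary.Decidable using (yes; no; map′; ¬?)
open import Relation.Nullary.Negation.Core using (contradiction)
import Relation.Unary as Unary

-- Ring identities with integer coefficients

module IntegerRingSolver {c ℓ : Level} (R : CommutativeRing c ℓ) where

  open CommutativeRing R
  open RingProperties ring
  open Mult semiring renaming (_×_ to _·_)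
  open SetoidReasoning setoid

  -- The canonical homomorphism from the integers.
  fromℤ : ℤ → Carrier
  fromℤ (+ n)    = n · 1#
  fromℤ -[1+ n ] = - (suc n · 1#)

  fromℤ-neg : ∀ i → fromℤ (ℤ.- i) ≈ - fromℤ i
  fromℤ-neg (+ 0)       = sym -0#≈0#
  fromℤ-neg (+ (suc n)) = refl
  fromℤ-neg -[1+ n ]    = sym (-‿involutive _)

  fromℤ-⊖ : ∀ m n → fromℤ (m ⊖ n) ≈ m · 1# - n · 1#
  fromℤ-⊖ m zero = sym (trans (+-congˡ -0#≈0#) (+-identityʳ _))
  fromℤ-⊖ zero (suc n) = sym (+-identityˡ _)
  fromℤ-⊖ (suc m) (suc n) = begin
    fromℤ (suc m ⊖ suc n)              ≡⟨ ≡.cong fromℤ (ℤ.[1+m]⊖[1+n]≡m⊖n m n) ⟩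
    fromℤ (m ⊖ n)                      ≈⟨ fromℤ-⊖ m n ⟩
    a - b                             ≈⟨ +-congʳ (+-identityʳ a) ⟨
    a + 0# - b                        ≈⟨ +-congʳ (+-congˡ (-‿inverseʳ 1#)) ⟨
    a + (1# - 1#) - b                ≈⟨ +-congʳ (+-assoc a 1# _) ⟨
    a + 1# - 1# - b                  ≈⟨ +-assoc _ _ _ ⟩
    a + 1# + (- 1# - b)               ≈⟨ +-cong (+-comm a 1#) (-‿+-comm 1# b) ⟩
    1# + a - (1# + b)                 ≈⟨ +-cong (1+× m 1#) (-‿cong (1+× n 1#)) ⟨
    suc m · 1# - suc n · 1#           ∎
    where
    a = m · 1#
    b = n · 1#

  fromℤ-+ : ∀ i j → fromℤ (i ℤ.+ j) ≈ fromℤ i + fromℤ j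
  fromℤ-+ (+ m)    (+ n)    = ×-homo-+ 1# m n
  fromℤ-+ (+ m)    -[1+ n ] = fromℤ-⊖ m (suc n)
  fromℤ-+ -[1+ m ] (+ n)    = trans (fromℤ-⊖ n (suc m)) (+-comm _ _)
  fromℤ-+ -[1+ m ] -[1+ n ] = begin
    - (suc (suc (m ℕ.+ n)) · 1#)       ≡⟨ ≡.cong (λ k → - (k · 1#)) (ℕ.+-suc (suc m) n) ⟨
    - ((suc m ℕ.+ suc n) · 1#)         ≈⟨ -‿cong (×-homo-+ 1# (suc m) (suc n)) ⟩
    - (suc m · 1# + suc n · 1#)      ≈⟨ -‿+-comm _ _ ⟨
    - (suc m · 1#) + - (suc n · 1#)  ∎

  fromℤ-*⁺ : ∀ m n → fromℤ (+ m ℤ.* + n) ≈ m · 1# * n · 1#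
  fromℤ-*⁺ m n = begin
    fromℤ (+ m ℤ.* + n)   ≡⟨ ≡.cong fromℤ (ℤ.pos-* m n) ⟨
    (m ℕ.* n) · 1#        ≈⟨ ×1-homo-* m n ⟩
    m · 1# * n · 1#       ∎

  fromℤ-*ʳ : ∀ m j → fromℤ (+ m ℤ.* j) ≈ m · 1# * fromℤ j
  fromℤ-*ʳ m (+ n)    = fromℤ-*⁺ m n
  fromℤ-*ʳ m -[1+ n ] = begin
    fromℤ (+ m ℤ.* -[1+ n ])           ≡⟨ ≡.cong fromℤ (ℤ.neg-distribʳ-* (+ m) (+ suc n)) ⟨
    fromℤ (ℤ.- (+ m ℤ.* + suc n))      ≈⟨ fromℤ-neg (+ m ℤ.* + suc n) ⟩
    - fromℤ (+ m ℤ.* + suc n)          ≈⟨ -‿cong (fromℤ-*⁺ m (suc n)) ⟩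
    - (m · 1# * suc n · 1#)            ≈⟨ -‿distribʳ-* _ _ ⟩
    m · 1# * - (suc n · 1#)            ∎

  fromℤ-* : ∀ i j → fromℤ (i ℤ.* j) ≈ fromℤ i * fromℤ j
  fromℤ-* (+ m)    j = fromℤ-*ʳ m j
  fromℤ-* -[1+ m ] j = begin
    fromℤ (-[1+ m ] ℤ.* j)             ≡⟨ ≡.cong fromℤ (ℤ.neg-distribˡ-* (+ suc m) j) ⟨
    fromℤ (ℤ.- (+ suc m ℤ.* j))        ≈⟨ fromℤ-neg (+ suc m ℤ.* j) ⟩
    - fromℤ (+ suc m ℤ.* j)            ≈⟨ -‿cong (fromℤ-*ʳ (suc m) j) ⟩
    - (suc m · 1# * fromℤ j)           ≈⟨ -‿distribˡ-* _ _ ⟩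
    - (suc m · 1#) * fromℤ j           ∎

  fromℤ-homomorphism :
    ℤ.+-*-rawRing -Raw-AlmostCommutative⟶ fromCommutativeRing R
  fromℤ-homomorphism = record
    { ⟦_⟧    = fromℤ
    ; +-homo = fromℤ-+
    ; *-homo = fromℤ-*
    ; -‿homo = fromℤ-neg
    ; 0-homo = refl
    ; 1-homo = refl
    }

  -- Only equal integers are recognised as equal coefficients, so the solver
  -- proves exactly the identities that hold in every commutative ring.
  fromℤ-≟ : ∀ i j → Maybe (fromℤ i ≈ fromℤ j)
  fromℤ-≟ i j with i ℤ.≟ j
  ... | yes i≡j = just (reflexive (≡.cong fromℤ i≡j))
  ... | no _    = nothing

  open RingSolver ℤ.+-*-rawRing (fromCommutativeRing R) fromℤ-homomorphism fromℤ-≟ public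
    using (con; solve; _:=_; _:+_; _:*_; _:-_; :-_)

-- Finite fields

module FiniteField {n : ℕ} {c ℓ₁ ℓ₂ : Level} (F : GaloisField n c ℓ₁ ℓ₂) where

  open GaloisField F public hiding (zero)
  open CommutativeRing commutativeRing public
    using (semiring; ring; *-commutativeMonoid)
  open RingProperties ring public using (-‿involutive; -0#≈0#)
  open Exp semiring public
  open IntegerRingSolver commutativeRing public
  open Inverse enumeration public
    using (to; from; to-cong; strictlyInverseˡ; strictlyInverseʳ)
  open SetoidReasoning setoid

  infix 4 _≉_ _≈?_

  _≉_ : Carrier → Carrier → Set ℓ₁
  x ≉ y = ¬ (x ≈ y)

  to-injective : ∀ {x y} → to x ≡ to y → x ≈ y
  to-injective {x} {y} eq = begin
    x            ≈⟨ strictlyInverseʳ x ⟨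
    from (to x)  ≡⟨ ≡.cong from eq ⟩
    from (to y)  ≈⟨ strictlyInverseʳ y ⟩
    y            ∎

  from-injective : ∀ {i j} → from i ≈ from j → i ≡ j
  from-injective {i} {j} eq =
    ≡.trans (≡.sym (strictlyInverseˡ i)) (≡.trans (to-cong eq) (strictlyInverseˡ j))

  _≈?_ : Decidable _≈_
  x ≈? y = map′ to-injective to-cong (to x Fin.≟ to y)

  x-0≈x : ∀ x → x - 0# ≈ x
  x-0≈x = solve 1 (λ x → x :- con (+ 0) := x) refl

  #⇒≉ : ∀ {x y} → x # y → x ≉ y
  #⇒≉ x#y x≈y = proj₂ (tight _ _) x≈y x#y

  -- An inverse is found by searching the finitely many elements; an element
  -- without inverse is not apart from 0, hence is 0 by tightness.
  inverse : ∀ {x} → x ≉ 0# → ∃[ y ] y * x ≈ 1#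
  inverse {x} x≉0 with Fin.any? (λ i → (from i * x) ≈? 1#)
  ... | yes (i , eq) = from i , eq
  ... | no none = contradiction (proj₁ (tight x 0#) ¬x#0) x≉0
    where
    ¬x#0 : ¬ (x # 0#)
    ¬x#0 x#0 with #⇒invertible x#0
    ... | y , y[x-0]≈1 , _ = none (to y , (begin
      from (to y) * x  ≈⟨ *-cong (strictlyInverseʳ y) (sym (x-0≈x x)) ⟩
      y * (x - 0#)     ≈⟨ y[x-0]≈1 ⟩
      1#               ∎))

  ≉0⇒#0 : ∀ {x} → x ≉ 0# → x # 0#
  ≉0⇒#0 {x} x≉0 with inverse x≉0
  ... | y , yx≈1 = invertible⇒# (y , trans (*-congˡ (x-0≈x x)) yx≈1 ,
                                 trans (*-comm _ _) (trans (*-congˡ (x-0≈x x)) yx≈1))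

  1≉0 : 1# ≉ 0#
  1≉0 = #⇒≉ (invertible⇒# (1# , trans (*-identityˡ _) (x-0≈x 1#) ,
                           trans (*-identityʳ _) (x-0≈x 1#)))

  *-cancelˡ-≉0 : ∀ {x y z} → x ≉ 0# → x * y ≈ x * z → y ≈ z
  *-cancelˡ-≉0 {x} {y} {z} x≉0 xy≈xz with inverse x≉0
  ... | w , wx≈1 = begin
    y            ≈⟨ *-identityˡ y ⟨
    1# * y       ≈⟨ *-congʳ wx≈1 ⟨
    w * x * y    ≈⟨ *-assoc w x y ⟩
    w * (x * y)  ≈⟨ *-congˡ xy≈xz ⟩
    w * (x * z)  ≈⟨ *-assoc w x z ⟨
    w * x * z    ≈⟨ *-congʳ wx≈1 ⟩
    1# * z       ≈⟨ *-identityˡ z ⟩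
    z            ∎

  xy≈0⇒y≈0 : ∀ {x y} → x ≉ 0# → x * y ≈ 0# → y ≈ 0#
  xy≈0⇒y≈0 x≉0 xy≈0 = *-cancelˡ-≉0 x≉0 (trans xy≈0 (sym (zeroʳ _)))

  *-≉0 : ∀ {x y} → x ≉ 0# → y ≉ 0# → x * y ≉ 0#
  *-≉0 x≉0 y≉0 xy≈0 = y≉0 (xy≈0⇒y≈0 x≉0 xy≈0)

  x-y≈0⇒x≈y : ∀ {x y} → x - y ≈ 0# → x ≈ y
  x-y≈0⇒x≈y {x} {y} x-y≈0 = begin
    x          ≈⟨ solve 2 (λ x y → x := x :- y :+ y) refl x y ⟩
    x - y + y  ≈⟨ +-congʳ x-y≈0 ⟩
    0# + y     ≈⟨ +-identityˡ y ⟩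
    y          ∎

  1^n≈1 : ∀ k → 1# ^ k ≈ 1#
  1^n≈1 zero    = refl
  1^n≈1 (suc k) = trans (*-identityˡ _) (1^n≈1 k)

  ^-distrib-* : ∀ x y k → (x * y) ^ k ≈ x ^ k * y ^ k
  ^-distrib-* x y zero    = sym (*-identityˡ 1#)
  ^-distrib-* x y (suc k) = begin
    x * y * (x * y) ^ k        ≈⟨ *-congˡ (^-distrib-* x y k) ⟩
    x * y * (x ^ k * y ^ k)    ≈⟨ solve 4 (λ x y a b → x :* y :* (a :* b) := x :* a :* (y :* b))
                                    refl x y (x ^ k) (y ^ k) ⟩
    x * x ^ k * (y * y ^ k)    ∎

  -- Fermat's little theorem: x ^ n = x in a field with n elements

  module Product = MonoidSum *-commutativeMonoid

  open Product using () renaming (sum to ∏)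

  -- A product with at most one factor different from 1.
  ∏-single : ∀ {m} (f : Vector Carrier m) (j : Fin m) →
             (∀ i → i ≢ j → f i ≈ 1#) → ∏ f ≈ f j
  ∏-single {suc m} f j others = begin
    ∏ f                               ≈⟨ Product.sum-remove {i = j} f ⟩
    f j * ∏ (Vector.removeAt f j)     ≈⟨ *-congˡ (Product.sum-cong-≋ {n = m}
                                           (λ i → others (punchIn j i) (Fin.punchInᵢ≢i j i))) ⟩
    f j * ∏ (Vector.replicate m 1#)   ≈⟨ *-congˡ (Product.sum-replicate-zero m) ⟩
    f j * 1#                          ≈⟨ *-identityʳ _ ⟩
    f j                               ∎

  ∏-≉0 : ∀ {m} (f : Vector Carrier m) → (∀ i → f i ≉ 0#) → ∏ f ≉ 0#
  ∏-≉0 {zero}  f f≉0 = 1≉0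
  ∏-≉0 {suc m} f f≉0 = *-≉0 (f≉0 zero) (∏-≉0 (f ∘ suc) (f≉0 ∘ suc))

  -- ifZero x y a is x when a is zero and y otherwise.
  ifZero : Carrier → Carrier → Carrier → Carrier
  ifZero x y a with a ≈? 0#
  ... | yes _ = x
  ... | no  _ = y

  ifZero-yes : ∀ {x y a} → a ≈ 0# → ifZero x y a ≈ x
  ifZero-yes {a = a} a≈0 with a ≈? 0#
  ... | yes _  = refl
  ... | no a≉0 = contradiction a≈0 a≉0

  ifZero-no : ∀ {x y a} → a ≉ 0# → ifZero x y a ≈ y
  ifZero-no {a = a} a≉0 with a ≈? 0#
  ... | yes a≈0 = contradiction a≈0 a≉0
  ... | no  _   = refl

  module _ (x : Carrier) (x≉0 : x ≉ 0#) where

    private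
      y = proj₁ (inverse x≉0)

      yx≈1 : y * x ≈ 1#
      yx≈1 = proj₂ (inverse x≉0)

    -- Multiplication by a nonzero element permutes the field.
    multiplication : Permutation′ n
    multiplication = permutation (λ i → to (x * from i)) (λ i → to (y * from i))
      (cancels x y (trans (*-comm x y) yx≈1)) (cancels y x yx≈1)
      where
      cancels : ∀ u v → u * v ≈ 1# → ∀ i → to (u * from (to (v * from i))) ≡ i
      cancels u v uv≈1 i = ≡.trans (to-cong (begin
        u * from (to (v * from i))  ≈⟨ *-congˡ (strictlyInverseʳ _) ⟩
        u * (v * from i)            ≈⟨ *-assoc u v _ ⟨
        u * v * from i              ≈⟨ *-congʳ uv≈1 ⟩
        1# * from i                 ≈⟨ *-identityˡ _ ⟩
        from i                      ∎)) (strictlyInverseˡ i)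

    -- Let g a be a, except that g 0 = 1, and let δ a be 1, except that δ 0 = x.
    -- Then g a * x = g (x * a) * δ a for every a.  Multiplying over all a, and
    -- reindexing the product of the g (x * a), gives G * x ^ n = G * x with
    -- G the product of all g a, and G is cancelled.
    fermat-≉0 : x ^ n ≈ x
    fermat-≉0 = *-cancelˡ-≉0 (∏-≉0 (g ∘ from) (λ i → g≉0 (from i))) (begin
      ∏ (g ∘ from) * x ^ n                         ≈⟨ *-congˡ (Product.sum-replicate n) ⟨
      ∏ (g ∘ from) * ∏ (Vector.replicate n x)      ≈⟨ Product.∑-distrib-+ (g ∘ from) (λ _ → x) ⟨
      ∏ (λ i → g (from i) * x)                     ≈⟨ Product.sum-cong-≋ {n = n} (λ i → step (from i)) ⟩
      ∏ (λ i → g (x * from i) * δ (from i))        ≈⟨ Product.∑-distrib-+ (λ i → g (x * from i)) (δ ∘ from) ⟩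
      ∏ (λ i → g (x * from i)) * ∏ (δ ∘ from)      ≈⟨ *-cong reindex (∏-single (δ ∘ from) (to 0#) only0) ⟩
      ∏ (g ∘ from) * δ (from (to 0#))              ≈⟨ *-congˡ (ifZero-yes (strictlyInverseʳ 0#)) ⟩
      ∏ (g ∘ from) * x                             ∎)
      where
      g δ : Carrier → Carrier
      g a = ifZero 1# a a
      δ a = ifZero x 1# a

      g≉0 : ∀ a → g a ≉ 0#
      g≉0 a with a ≈? 0#
      ... | yes _  = 1≉0
      ... | no a≉0 = a≉0

      g-cong : ∀ {a b} → a ≈ b → g a ≈ g b
      g-cong {a} {b} a≈b with a ≈? 0# | b ≈? 0#
      ... | yes _   | yes _   = refl
      ... | yes a≈0 | no b≉0  = contradiction (trans (sym a≈b) a≈0) b≉0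
      ... | no a≉0  | yes b≈0 = contradiction (trans a≈b b≈0) a≉0
      ... | no _    | no _    = a≈b

      step : ∀ a → g a * x ≈ g (x * a) * δ a
      step a with a ≈? 0#
      ... | yes a≈0 = *-congʳ (sym (ifZero-yes (trans (*-congˡ a≈0) (zeroʳ x))))
      ... | no a≉0  = begin
        a * x           ≈⟨ *-comm a x ⟩
        x * a           ≈⟨ *-identityʳ _ ⟨
        x * a * 1#      ≈⟨ *-congʳ (ifZero-no (*-≉0 x≉0 a≉0)) ⟨
        g (x * a) * 1#  ∎

      reindex : ∏ (λ i → g (x * from i)) ≈ ∏ (g ∘ from)
      reindex = begin
        ∏ (λ i → g (x * from i))              ≈⟨ Product.sum-cong-≋ {n = n}
                                                   (λ i → g-cong (sym (strictlyInverseʳ _))) ⟩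
        ∏ (λ i → g (from (to (x * from i))))  ≈⟨ Product.sum-permute (g ∘ from) multiplication ⟨
        ∏ (g ∘ from)                          ∎

      only0 : ∀ i → i ≢ to 0# → δ (from i) ≈ 1#
      only0 i i≢0 = ifZero-no (λ a≈0 →
        i≢0 (≡.trans (≡.sym (strictlyInverseˡ i)) (to-cong a≈0)))

  -- Monic polynomials

  -- The vector a₀ , … , aₘ₋₁ stands for Xᵐ + aₘ₋₁Xᵐ⁻¹ + … + a₀.
  Monic : ℕ → Set c
  Monic = Vec Carrier

  eval : ∀ {m} → Monic m → Carrier → Carrier
  eval []      x = 1#
  eval (a ∷ p) x = a + x * eval p x

  -- The quotient of p by X - r, by synthetic division.
  quotient : ∀ {m} → Carrier → Monic (suc m) → Monic m
  quotient {zero}  r _       = []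
  quotient {suc m} r (_ ∷ p) = eval p r ∷ quotient r p

  eval-quotient : ∀ {m} (p : Monic (suc m)) r x →
                  eval p x ≈ (x - r) * eval (quotient r p) x + eval p r
  eval-quotient {zero} (a ∷ []) r x =
    solve 3 (λ a r x → a :+ x :* con (+ 1) := (x :- r) :* con (+ 1) :+ (a :+ r :* con (+ 1)))
      refl a r x
  eval-quotient {suc m} (a ∷ p) r x = begin
    a + x * eval p x                    ≈⟨ +-congˡ (*-congˡ (eval-quotient p r x)) ⟩
    a + x * ((x - r) * s + eval p r)    ≈⟨ solve 5 (λ a r x s e →
                                             a :+ x :* ((x :- r) :* s :+ e) :=
                                             (x :- r) :* (e :+ x :* s) :+ (a :+ r :* e))
                                             refl a r x s (eval p r) ⟩
    (x - r) * (eval p r + x * s) + (a + r * eval p r)  ∎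
    where s = eval (quotient r p) x

  open Uniqueness setoid using (Unique)

  -- A monic polynomial of degree m has at most m roots.
  roots≤degree : ∀ {m} (p : Monic m) xs → Unique xs →
                 All (λ x → eval p x ≈ 0#) xs → length xs ℕ.≤ m
  roots≤degree         p  []       _             _             = z≤n
  roots≤degree {zero}  [] (x ∷ xs) _             (1≈0 ∷ _)     = contradiction 1≈0 1≉0
  roots≤degree {suc m} p  (r ∷ xs) (r∉xs ∷ xs!)  (pr≈0 ∷ pxs)  =
    s≤s (roots≤degree (quotient r p) xs xs!
      (All.zipWith (λ (r≉x , px≈0) → root r≉x px≈0) (r∉xs , pxs)))
    where
    root : ∀ {x} → r ≉ x → eval p x ≈ 0# → eval (quotient r p) x ≈ 0#
    root {x} r≉x px≈0 = xy≈0⇒y≈0 (λ x-r≈0 → r≉x (sym (x-y≈0⇒x≈y x-r≈0))) (begin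
      (x - r) * eval (quotient r p) x             ≈⟨ +-identityʳ _ ⟨
      (x - r) * eval (quotient r p) x + 0#        ≈⟨ +-congˡ pr≈0 ⟨
      (x - r) * eval (quotient r p) x + eval p r  ≈⟨ eval-quotient p r x ⟨
      eval p x                                    ≈⟨ px≈0 ⟩
      0#                                          ∎)

  eval-shift : ∀ k {m} (p : Monic m) x →
               eval (Vec.replicate k 0# Vec.++ p) x ≈ x ^ k * eval p x
  eval-shift zero    p x = sym (*-identityˡ _)
  eval-shift (suc k) p x = begin
    0# + x * eval (Vec.replicate k 0# Vec.++ p) x  ≈⟨ +-identityˡ _ ⟩
    x * eval (Vec.replicate k 0# Vec.++ p) x       ≈⟨ *-congˡ (eval-shift k p x) ⟩
    x * (x ^ k * eval p x)                         ≈⟨ *-assoc x _ _ ⟨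
    x * x ^ k * eval p x                           ∎

  -- The polynomial Xᵈ - 1 with d = k + 1.  The summand 0 in the degree is that
  -- of the constant polynomial 1, shifted to give the power of X.
  powerMinusOne : ∀ k → Monic (suc k ℕ.+ 0)
  powerMinusOne k = (- 1#) ∷ (Vec.replicate k 0# Vec.++ [])

  eval-powerMinusOne : ∀ k x → eval (powerMinusOne k) x ≈ x ^ suc k - 1#
  eval-powerMinusOne k x = begin
    - 1# + x * eval (Vec.replicate k 0# Vec.++ []) x  ≈⟨ +-congˡ (*-congˡ (eval-shift k [] x)) ⟩
    - 1# + x * (x ^ k * 1#)                           ≈⟨ solve 3 (λ o x y →
                                                           :- o :+ x :* (y :* con (+ 1)) := x :* y :- o)
                                                           refl 1# x (x ^ k) ⟩
    x * x ^ k - 1#                                    ∎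

  -- The geometric sum 1 + Xᵈ + … + Xᵈʲ with d = k + 1.
  geometricSum : ∀ k j → Monic (j ℕ.* suc k)
  geometricSum k zero    = []
  geometricSum k (suc j) = 1# ∷ (Vec.replicate k 0# Vec.++ geometricSum k j)

  eval-geometricSum : ∀ k j x → (x ^ suc k - 1#) * eval (geometricSum k j) x ≈
                                (x ^ suc k) ^ suc j - 1#
  eval-geometricSum k zero x =
    solve 2 (λ y o → (y :- o) :* con (+ 1) := y :* con (+ 1) :- o) refl (x ^ suc k) 1#
  eval-geometricSum k (suc j) x = begin
    (y - 1#) * (1# + x * eval (Vec.replicate k 0# Vec.++ geometricSum k j) x)
      ≈⟨ *-congˡ (+-congˡ (*-congˡ (eval-shift k (geometricSum k j) x))) ⟩
    (y - 1#) * (1# + x * (x ^ k * s))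
      ≈⟨ solve 3 (λ x z s → (x :* z :- con (+ 1)) :* (con (+ 1) :+ x :* (z :* s)) :=
                            x :* z :- con (+ 1) :+ x :* z :* ((x :* z :- con (+ 1)) :* s))
           refl x (x ^ k) s ⟩
    y - 1# + y * ((y - 1#) * s)
      ≈⟨ +-congˡ (*-congˡ (eval-geometricSum k j x)) ⟩
    y - 1# + y * (y ^ suc j - 1#)
      ≈⟨ solve 2 (λ y z → y :- con (+ 1) :+ y :* (z :- con (+ 1)) := y :* z :- con (+ 1))
           refl y (y ^ suc j) ⟩
    y * y ^ suc j - 1#
      ∎
    where
    y = x ^ suc k
    s = eval (geometricSum k j) x

-- Lengths of filtered lists

length-filter-split : ∀ {a p} {A : Set a} {P : Unary.Pred A p} (P? : Unary.Decidable P) xs →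
  length (filter P? xs) ℕ.+ length (filter (¬? ∘ P?) xs) ≡ length xs
length-filter-split P? [] = ≡.refl
length-filter-split P? (x ∷ xs) with P? x
... | yes _ = ≡.cong suc (length-filter-split P? xs)
... | no _  = ≡.trans (ℕ.+-suc _ _) (≡.cong suc (length-filter-split P? xs))

-- Elements of norm one

-- The norm from the field with q² elements to its subfield with q elements is
-- x ^ (q + 1); the subfield itself is never needed.  Writing q as r + 2 makes
-- the exponents q - 1 and q - 2 available as r + 1 and r.
module NormOne {r : ℕ} {c ℓ₁ ℓ₂ : Level}
               (F : GaloisField (suc (suc r) ℕ.^ 2) c ℓ₁ ℓ₂) where

  open FiniteField F
  open Uniqueness setoid using (Unique)
  open SetoidReasoning setoid

  q : ℕ
  q = suc (suc r)

  Norm1 : Carrier → Set ℓ₁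
  Norm1 x = x ^ suc q ≈ 1#

  norm1? : Unary.Decidable Norm1
  norm1? x = x ^ suc q ≈? 1#

  elements : List Carrier
  elements = tabulate from

  elements! : Unique elements
  elements! = UniqueProperties.tabulate⁺ setoid from-injective

  -- The field elements of norm one, and all the others (0 among them).
  norm1s others : List Carrier
  norm1s = filter norm1? elements
  others = filter (¬? ∘ norm1?) elements

  norm1s! : Unique norm1s
  norm1s! = UniqueProperties.filter⁺ setoid norm1? elements!

  others! : Unique others
  others! = UniqueProperties.filter⁺ setoid (¬? ∘ norm1?) elements!

  all-norm1 : All Norm1 norm1s
  all-norm1 = All.all-filter norm1? elements

  all-other : All (¬_ ∘ Norm1) others
  all-other = All.all-filter (¬? ∘ norm1?) elements

  q²≡1+[q-1][q+1] : q ℕ.^ 2 ≡ suc (suc r ℕ.* suc q)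
  q²≡1+[q-1][q+1] = expand r
    where
    expand : ∀ r → (2 ℕ.+ r) ℕ.* ((2 ℕ.+ r) ℕ.* 1) ≡ 1 ℕ.+ (1 ℕ.+ r) ℕ.* (3 ℕ.+ r)
    expand = ℕ-Ring.solve-∀

  -- Fermat's little theorem, divided by x, in terms of the norm.
  fermat : ∀ {x} → x ≉ 0# → (x ^ suc q) ^ suc r ≈ 1#
  fermat {x} x≉0 = *-cancelˡ-≉0 x≉0 (begin
    x * (x ^ suc q) ^ suc r    ≈⟨ *-congˡ (^-assocʳ x (suc q) (suc r)) ⟩
    x * x ^ (suc q ℕ.* suc r)  ≡⟨ ≡.cong (λ k → x * x ^ k) (ℕ.*-comm (suc q) (suc r)) ⟩
    x ^ suc (suc r ℕ.* suc q)  ≡⟨ ≡.cong (x ^_) q²≡1+[q-1][q+1] ⟨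
    x ^ (q ℕ.^ 2)              ≈⟨ fermat-≉0 x x≉0 ⟩
    x                          ≈⟨ *-identityʳ x ⟨
    x * 1#                     ∎)

  norm1s-≤ : length norm1s ℕ.≤ suc q
  norm1s-≤ = ≡.subst (length norm1s ℕ.≤_) (ℕ.+-identityʳ (suc q))
    (roots≤degree (powerMinusOne q) norm1s norm1s! (All.map root all-norm1))
    where
    root : ∀ {x} → Norm1 x → eval (powerMinusOne q) x ≈ 0#
    root {x} x∈N = begin
      eval (powerMinusOne q) x  ≈⟨ eval-powerMinusOne q x ⟩
      x ^ suc q - 1#            ≈⟨ +-congʳ x∈N ⟩
      1# - 1#                   ≈⟨ -‿inverseʳ 1# ⟩
      0#                        ∎

  -- The elements of norm different from one are roots of
  -- X (1 + Xᵈ + … + Xᵈʳ) with d = q + 1, which is the quotient of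
  -- X (X^(q² - 1) - 1) by Xᵈ - 1.
  others-≤ : length others ℕ.≤ suc (r ℕ.* suc q)
  others-≤ = roots≤degree (0# ∷ geometricSum q r) others others! (All.map root all-other)
    where
    root : ∀ {x} → ¬ Norm1 x → 0# + x * eval (geometricSum q r) x ≈ 0#
    root {x} x∉N with x ≈? 0#
    ... | yes x≈0 = trans (+-identityˡ _) (trans (*-congʳ x≈0) (zeroˡ _))
    ... | no  x≉0 = trans (+-identityˡ _) (trans (*-congˡ sum≈0) (zeroʳ x))
      where
      sum≈0 : eval (geometricSum q r) x ≈ 0#
      sum≈0 = xy≈0⇒y≈0 (x∉N ∘ x-y≈0⇒x≈y) (begin
        (x ^ suc q - 1#) * eval (geometricSum q r) x  ≈⟨ eval-geometricSum q r x ⟩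
        (x ^ suc q) ^ suc r - 1#                      ≈⟨ +-congʳ (fermat x≉0) ⟩
        1# - 1#                                       ≈⟨ -‿inverseʳ 1# ⟩
        0#                                            ∎)

  norm1s+others : length norm1s ℕ.+ length others ≡ suc q ℕ.+ suc (r ℕ.* suc q)
  norm1s+others = ≡.trans (length-filter-split norm1? elements)
    (≡.trans (List.length-tabulate from)
      (≡.trans q²≡1+[q-1][q+1] (≡.sym (ℕ.+-suc (suc q) (r ℕ.* suc q)))))

  -- Both bounds are attained, since they add up to q².
  |norm1s| : length norm1s ≡ suc q
  |norm1s| = ℕ.≤-antisym norm1s-≤ (ℕ.+-cancelʳ-≤ (length others) _ _
    (ℕ.≤-trans (ℕ.+-monoʳ-≤ (suc q) others-≤) (ℕ.≤-reflexive (≡.sym norm1s+others))))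

  |others| : length others ≡ suc (r ℕ.* suc q)
  |others| = ℕ.+-cancelˡ-≡ (suc q) _ _
    (≡.trans (≡.cong (ℕ._+ length others) (≡.sym |norm1s|)) norm1s+others)

  -- In characteristic two: -1 equals (-1)^(q²), which is 1 when q is even.
  even⇒1+1≈0 : 2 ∣ q → 1# + 1# ≈ 0#
  even⇒1+1≈0 2∣q with ∣m⇒∣m*n (q ℕ.* 1) 2∣q
  ... | divides k q²≡k*2 = begin
    1# + 1#       ≈⟨ +-congˡ -1≈1 ⟨
    1# - 1#       ≈⟨ -‿inverseʳ 1# ⟩
    0#            ∎
    where
    -1≉0 : - 1# ≉ 0#
    -1≉0 -1≈0 = 1≉0 (trans (sym (-‿involutive 1#)) (trans (-‿cong -1≈0) -0#≈0#))

    -1≈1 : - 1# ≈ 1#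
    -1≈1 = begin
      - 1#                ≈⟨ fermat-≉0 (- 1#) -1≉0 ⟨
      (- 1#) ^ (q ℕ.^ 2)  ≡⟨ ≡.cong ((- 1#) ^_) (≡.trans q²≡k*2 (ℕ.*-comm k 2)) ⟩
      (- 1#) ^ (2 ℕ.* k)  ≈⟨ ^-assocʳ (- 1#) 2 k ⟨
      ((- 1#) ^ 2) ^ k    ≈⟨ ^-congˡ k (solve 0
                               (:- con (+ 1) :* (:- con (+ 1) :* con (+ 1)) := con (+ 1)) refl) ⟩
      1# ^ k              ≈⟨ 1^n≈1 k ⟩
      1#                  ∎

-- Determinants and incidence in the plane

module Plane {n : ℕ} {c ℓ₁ ℓ₂ : Level} (F : GaloisField n c ℓ₁ ℓ₂) where

  open FiniteField F
  open ProjectivePlane F public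
  open Setoid pointSetoid public
    using () renaming (refl to ∼-refl; sym to ∼-sym; trans to ∼-trans)
  open SetoidReasoning setoid

  triple : ∀ {a} {A : Set a} → A → A → A → Vector A 3
  triple x y z = x Vector.∷ y Vector.∷ z Vector.∷ Vector.[]

  -- The determinant of the matrix with rows p, q, r.
  det : (p q r : Vector Carrier 3) → Carrier
  det p q r = p 0F * (q 1F * r 2F - q 2F * r 1F)
            + p 1F * (q 2F * r 0F - q 0F * r 2F)
            + p 2F * (q 0F * r 1F - q 1F * r 0F)

  det-rotate : ∀ p q r → det p q r ≈ det q r p
  det-rotate p q r =
    solve 9 (λ p₀ p₁ p₂ q₀ q₁ q₂ r₀ r₁ r₂ →
      p₀ :* (q₁ :* r₂ :- q₂ :* r₁) :+ p₁ :* (q₂ :* r₀ :- q₀ :* r₂) :+ p₂ :* (q₀ :* r₁ :- q₁ :* r₀) :=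
      q₀ :* (r₁ :* p₂ :- r₂ :* p₁) :+ q₁ :* (r₂ :* p₀ :- r₀ :* p₂) :+ q₂ :* (r₀ :* p₁ :- r₁ :* p₀))
      refl (p 0F) (p 1F) (p 2F) (q 0F) (q 1F) (q 2F) (r 0F) (r 1F) (r 2F)

  det-transpose : ∀ p q r →
    det (λ j → triple p q r j 0F) (λ j → triple p q r j 1F) (λ j → triple p q r j 2F) ≈ det p q r
  det-transpose p q r =
    solve 9 (λ p₀ p₁ p₂ q₀ q₁ q₂ r₀ r₁ r₂ →
      p₀ :* (q₁ :* r₂ :- r₁ :* q₂) :+ q₀ :* (r₁ :* p₂ :- p₁ :* r₂) :+ r₀ :* (p₁ :* q₂ :- q₁ :* p₂) :=
      p₀ :* (q₁ :* r₂ :- q₂ :* r₁) :+ p₁ :* (q₂ :* r₀ :- q₀ :* r₂) :+ p₂ :* (q₀ :* r₁ :- q₁ :* r₀))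
      refl (p 0F) (p 1F) (p 2F) (q 0F) (q 1F) (q 2F) (r 0F) (r 1F) (r 2F)

  -- Cramer's rule for the first coefficient of a linear relation.
  cramer : ∀ p q r a b c → (∀ i → a * p i + (b * q i + (c * r i + 0#)) ≈ 0#) →
           a * det p q r ≈ 0#
  cramer p q r a b c relation = begin
    a * det p q r
      ≈⟨ solve 12 (λ a b c p₀ p₁ p₂ q₀ q₁ q₂ r₀ r₁ r₂ →
           a :* (p₀ :* (q₁ :* r₂ :- q₂ :* r₁) :+ p₁ :* (q₂ :* r₀ :- q₀ :* r₂) :+ p₂ :* (q₀ :* r₁ :- q₁ :* r₀)) :=
           (a :* p₀ :+ (b :* q₀ :+ (c :* r₀ :+ con (+ 0)))) :* (q₁ :* r₂ :- q₂ :* r₁) :+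
           (a :* p₁ :+ (b :* q₁ :+ (c :* r₁ :+ con (+ 0)))) :* (q₂ :* r₀ :- q₀ :* r₂) :+
           (a :* p₂ :+ (b :* q₂ :+ (c :* r₂ :+ con (+ 0)))) :* (q₀ :* r₁ :- q₁ :* r₀))
           refl a b c (p 0F) (p 1F) (p 2F) (q 0F) (q 1F) (q 2F) (r 0F) (r 1F) (r 2F) ⟩
    (a * p 0F + (b * q 0F + (c * r 0F + 0#))) * (q 1F * r 2F - q 2F * r 1F) +
    (a * p 1F + (b * q 1F + (c * r 1F + 0#))) * (q 2F * r 0F - q 0F * r 2F) +
    (a * p 2F + (b * q 2F + (c * r 2F + 0#))) * (q 0F * r 1F - q 1F * r 0F)
      ≈⟨ +-cong (+-cong (*-congʳ (relation 0F)) (*-congʳ (relation 1F))) (*-congʳ (relation 2F)) ⟩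
    0# * (q 1F * r 2F - q 2F * r 1F) + 0# * (q 2F * r 0F - q 0F * r 2F) +
    0# * (q 0F * r 1F - q 1F * r 0F)
      ≈⟨ +-cong (+-cong (zeroˡ _) (zeroˡ _)) (zeroˡ _) ⟩
    0# + 0# + 0#
      ≈⟨ trans (+-identityʳ _) (+-identityʳ _) ⟩
    0# ∎

  det≉0⇒independent : ∀ p q r → det p q r ≉ 0# → LinearlyIndependent (triple p q r)
  det≉0⇒independent p q r det≉0 a relation = coefficient
    where
    rotate : ∀ x y z → x + (y + (z + 0#)) ≈ y + (z + (x + 0#))
    rotate = solve 3 (λ x y z → x :+ (y :+ (z :+ con (+ 0))) := y :+ (z :+ (x :+ con (+ 0)))) refl

    relation₁ : ∀ i → a 1F * q i + (a 2F * r i + (a 0F * p i + 0#)) ≈ 0#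
    relation₁ i = trans (sym (rotate _ _ _)) (relation i)

    relation₂ : ∀ i → a 2F * r i + (a 0F * p i + (a 1F * q i + 0#)) ≈ 0#
    relation₂ i = trans (sym (rotate _ _ _)) (relation₁ i)

    vanishes : ∀ {x} → x * det p q r ≈ 0# → x ≈ 0#
    vanishes eq = xy≈0⇒y≈0 det≉0 (trans (*-comm _ _) eq)

    coefficient : ∀ j → a j ≈ 0#
    coefficient 0F = vanishes (cramer p q r (a 0F) (a 1F) (a 2F) relation)
    coefficient 1F = vanishes (trans (*-congˡ (det-rotate p q r))
      (cramer q r p (a 1F) (a 2F) (a 0F) relation₁))
    coefficient 2F = vanishes (trans (*-congˡ (sym (det-rotate r p q)))
      (cramer r p q (a 2F) (a 0F) (a 1F) relation₂))

  -- A common line of three points is a linear relation between the columns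
  -- of their coordinate matrix.
  det≉0⇒noncollinear : ∀ P Q R → det (coords P) (coords Q) (coords R) ≉ 0# →
                       ¬ Collinear P Q R
  det≉0⇒noncollinear P Q R det≉0 ((ψ , i , ψᵢ#0) , P∈ψ , Q∈ψ , R∈ψ) =
    #⇒≉ ψᵢ#0 (det≉0⇒independent (column 0F) (column 1F) (column 2F)
      (λ eq → det≉0 (trans (sym (det-transpose (coords P) (coords Q) (coords R))) eq)) ψ relation i)
    where
    column : Fin 3 → Vector Carrier 3
    column i j = triple (coords P) (coords Q) (coords R) j i

    relation : ∀ j → ψ 0F * column 0F j + (ψ 1F * column 1F j + (ψ 2F * column 2F j + 0#)) ≈ 0#
    relation 0F = P∈ψ
    relation 1F = Q∈ψ
    relation 2F = R∈ψ

  -- The three points form a triangle; nondegenerate-resp shows that this does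
  -- not depend on the choice of homogeneous coordinates.
  Nondegenerate : Point → Point → Point → Set ℓ₁
  Nondegenerate P Q R = det (coords P) (coords Q) (coords R) ≉ 0#

  nondegenerate-rotate : ∀ P Q R → Nondegenerate P Q R → Nondegenerate Q R P
  nondegenerate-rotate P Q R PQR≉0 QRP≈0 =
    PQR≉0 (trans (det-rotate (coords P) (coords Q) (coords R)) QRP≈0)

  nondegenerate-resp₁ : ∀ P P′ Q R → P′ ∼ P → Nondegenerate P′ Q R → Nondegenerate P Q R
  nondegenerate-resp₁ (p , _) (p′ , _) (q , _) (r , _) (a , _ , p′≈ap) P′QR≉0 PQR≈0 = P′QR≉0 (begin
    det p′ q r                 ≈⟨ +-cong (+-cong (*-congʳ (p′≈ap 0F)) (*-congʳ (p′≈ap 1F))) (*-congʳ (p′≈ap 2F)) ⟩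
    det (λ i → a * p i) q r    ≈⟨ solve 7 (λ a p₀ p₁ p₂ u v w →
                                    a :* p₀ :* u :+ a :* p₁ :* v :+ a :* p₂ :* w :=
                                    a :* (p₀ :* u :+ p₁ :* v :+ p₂ :* w))
                                    refl a (p 0F) (p 1F) (p 2F) _ _ _ ⟩
    a * det p q r              ≈⟨ *-congˡ PQR≈0 ⟩
    a * 0#                     ≈⟨ zeroʳ a ⟩
    0#                         ∎)

  nondegenerate-resp : ∀ {P P′ Q Q′ R R′} → P′ ∼ P → Q′ ∼ Q → R′ ∼ R →
                       Nondegenerate P′ Q′ R′ → Nondegenerate P Q R
  nondegenerate-resp {P} {P′} {Q} {Q′} {R} {R′} P′∼P Q′∼Q R′∼R =
    nondegenerate-rotate R P Q ∘ nondegenerate-resp₁ R R′ P Q R′∼R ∘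
    nondegenerate-rotate Q R′ P ∘ nondegenerate-resp₁ Q Q′ R′ P Q′∼Q ∘
    nondegenerate-rotate P Q′ R′ ∘ nondegenerate-resp₁ P P′ Q′ R′ P′∼P

  -- Points with proportional coordinates are equal.
  parallel⇒∼ : ∀ P Q → (∀ i j → coords P i * coords Q j ≈ coords P j * coords Q i) → P ∼ Q
  parallel⇒∼ (p , i , pᵢ#0) (q , j , qⱼ#0) parallel with inverse (#⇒≉ qⱼ#0)
  ... | y , yqⱼ≈1 = p j * y , ≉0⇒#0 (λ a≈0 → #⇒≉ pᵢ#0 (begin
      p i            ≈⟨ scaled i ⟩
      p j * y * q i  ≈⟨ *-congʳ a≈0 ⟩
      0# * q i       ≈⟨ zeroˡ _ ⟩
      0#             ∎)) , scaled
    where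
    scaled : ∀ k → p k ≈ p j * y * q k
    scaled k = begin
      p k              ≈⟨ *-identityʳ _ ⟨
      p k * 1#         ≈⟨ *-congˡ yqⱼ≈1 ⟨
      p k * (y * q j)  ≈⟨ solve 3 (λ a y b → a :* (y :* b) := y :* (a :* b)) refl (p k) y (q j) ⟩
      y * (p k * q j)  ≈⟨ *-congˡ (parallel k j) ⟩
      y * (p j * q k)  ≈⟨ solve 3 (λ y a b → y :* (a :* b) := a :* y :* b) refl y (p j) (q k) ⟩
      p j * y * q k    ∎

  -- The line with equation X₂ = 0.
  ℓ∞ : Line
  ℓ∞ = triple 0# 0# 1# , 2F , ≉0⇒#0 1≉0

  equation-ℓ∞ : ∀ (p : Vector Carrier 3) → 0# * p 0F + (0# * p 1F + (1# * p 2F + 0#)) ≈ p 2F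
  equation-ℓ∞ p = solve 3 (λ x y z → con (+ 0) :* x :+ (con (+ 0) :* y :+ (con (+ 1) :* z :+ con (+ 0))) := z)
    refl (p 0F) (p 1F) (p 2F)

  ∈ℓ∞⇒ : ∀ P → P ∈ₗ ℓ∞ → coords P 2F ≈ 0#
  ∈ℓ∞⇒ P = trans (sym (equation-ℓ∞ (coords P)))

  ∈ℓ∞⇐ : ∀ P → coords P 2F ≈ 0# → P ∈ₗ ℓ∞
  ∈ℓ∞⇐ P = trans (equation-ℓ∞ (coords P))

  ∈ℓ∞-resp : ∀ {P Q} → P ∼ Q → Q ∈ₗ ℓ∞ → P ∈ₗ ℓ∞
  ∈ℓ∞-resp {P} {Q} (a , _ , p≈aq) Q∈ =
    ∈ℓ∞⇐ P (trans (p≈aq 2F) (trans (*-congˡ (∈ℓ∞⇒ Q Q∈)) (zeroʳ a)))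

  -- The determinant deciding equality of two points of ℓ∞.
  minor : Point → Point → Carrier
  minor P Q = coords P 0F * coords Q 1F - coords P 1F * coords Q 0F

  distinct⇒minor≉0 : ∀ P Q → P ∈ₗ ℓ∞ → Q ∈ₗ ℓ∞ → ¬ (P ∼ Q) → minor P Q ≉ 0#
  distinct⇒minor≉0 P Q P∈ Q∈ P≁Q minor≈0 = P≁Q (parallel⇒∼ P Q parallel)
    where
    p = coords P
    q = coords Q

    p₂≈0 : p 2F ≈ 0#
    p₂≈0 = ∈ℓ∞⇒ P P∈

    q₂≈0 : q 2F ≈ 0#
    q₂≈0 = ∈ℓ∞⇒ Q Q∈

    01-parallel : p 0F * q 1F ≈ p 1F * q 0F
    01-parallel = x-y≈0⇒x≈y minor≈0

    both≈0 : ∀ {x y} → y * q 2F ≈ p 2F * x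
    both≈0 {x} {y} = trans (trans (*-congˡ q₂≈0) (zeroʳ y)) (sym (trans (*-congʳ p₂≈0) (zeroˡ x)))

    parallel : ∀ i j → p i * q j ≈ p j * q i
    parallel 0F 0F = refl
    parallel 0F 1F = 01-parallel
    parallel 1F 0F = sym 01-parallel
    parallel 1F 1F = refl
    parallel i  2F = both≈0
    parallel 2F 0F = sym both≈0
    parallel 2F 1F = sym both≈0

  distinct⇒independent : ∀ P Q → P ∈ₗ ℓ∞ → Q ∈ₗ ℓ∞ → ¬ (P ∼ Q) →
                         LinearlyIndependent (coords P Vector.∷ coords Q Vector.∷ Vector.[])
  distinct⇒independent P Q P∈ Q∈ P≁Q a relation = coefficient
    where
    p = coords P
    q = coords Q

    -- u and v are the multipliers of the two relations that eliminate the
    -- other coefficient.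
    vanishes : ∀ {x} u v → x * minor P Q ≈ (a 0F * p 0F + (a 1F * q 0F + 0#)) * u +
                                          (a 0F * p 1F + (a 1F * q 1F + 0#)) * v → x ≈ 0#
    vanishes {x} u v eq = xy≈0⇒y≈0 (distinct⇒minor≉0 P Q P∈ Q∈ P≁Q) (begin
      minor P Q * x    ≈⟨ *-comm _ _ ⟩
      x * minor P Q    ≈⟨ eq ⟩
      _                ≈⟨ +-cong (*-congʳ (relation 0F)) (*-congʳ (relation 1F)) ⟩
      0# * u + 0# * v  ≈⟨ +-cong (zeroˡ u) (zeroˡ v) ⟩
      0# + 0#          ≈⟨ +-identityʳ _ ⟩
      0#               ∎)

    coefficient : ∀ j → a j ≈ 0#
    coefficient 0F = vanishes (q 1F) (- q 0F)
      (solve 6 (λ a b p₀ p₁ q₀ q₁ → a :* (p₀ :* q₁ :- p₁ :* q₀) :=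
         (a :* p₀ :+ (b :* q₀ :+ con (+ 0))) :* q₁ :+ (a :* p₁ :+ (b :* q₁ :+ con (+ 0))) :* (:- q₀))
         refl (a 0F) (a 1F) (p 0F) (p 1F) (q 0F) (q 1F))
    coefficient 1F = vanishes (- p 1F) (p 0F)
      (solve 6 (λ a b p₀ p₁ q₀ q₁ → b :* (p₀ :* q₁ :- p₁ :* q₀) :=
         (a :* p₀ :+ (b :* q₀ :+ con (+ 0))) :* (:- p₁) :+ (a :* p₁ :+ (b :* q₁ :+ con (+ 0))) :* p₀)
         refl (a 0F) (a 1F) (p 0F) (p 1F) (q 0F) (q 1F))

  open Uniqueness pointSetoid using (Unique)

  lookup-injective : ∀ {xs} → Unique xs → ∀ i j → lookup xs i ∼ lookup xs j → i ≡ j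
  lookup-injective                (_ ∷ _)      zero    zero    _  = ≡.refl
  lookup-injective {_ ∷ xs}       (x∉xs ∷ _)   zero    (suc j) eq =
    contradiction eq (All.lookup x∉xs (∈-lookup j))
  lookup-injective {x ∷ xs}       (x∉xs ∷ _)   (suc i) zero    eq =
    contradiction (∼-sym {lookup xs i} {x} eq) (All.lookup x∉xs (∈-lookup i))
  lookup-injective                (_ ∷ xs!)    (suc i) (suc j) eq =
    ≡.cong suc (lookup-injective xs! i j eq)

  -- A list of pairwise different points as a set of points.
  fromList : (xs : List Point) → Unique xs → PointSet (length xs)
  fromList xs xs! = record
    { to        = lookup xs
    ; cong      = λ { ≡.refl → ∼-refl {lookup xs _} }
    ; injective = λ {i} {j} → lookup-injective xs! i j
    }

[q+2]+[q²∸q]≡q²+2 : ∀ q .{{_ : ℕ.NonZero q}} → q ℕ.+ 2 ℕ.+ (q ℕ.^ 2 ℕ.∸ q) ≡ q ℕ.^ 2 ℕ.+ 2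
[q+2]+[q²∸q]≡q²+2 q = begin
  q ℕ.+ 2 ℕ.+ (q ℕ.^ 2 ℕ.∸ q)    ≡⟨ ≡.cong (ℕ._+ (q ℕ.^ 2 ℕ.∸ q)) (ℕ.+-comm q 2) ⟩
  2 ℕ.+ (q ℕ.+ (q ℕ.^ 2 ℕ.∸ q))  ≡⟨ ≡.cong (2 ℕ.+_) (ℕ.m+[n∸m]≡n q≤q²) ⟩
  2 ℕ.+ q ℕ.^ 2                  ≡⟨ ℕ.+-comm 2 (q ℕ.^ 2) ⟩
  q ℕ.^ 2 ℕ.+ 2                  ∎
  where
  open ≡-Reasoning

  q≤q² : q ℕ.≤ q ℕ.^ 2
  q≤q² = ℕ.m≤m*n q (q ℕ.* 1) {{ℕ.m*n≢0 q 1}}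

-- The conic, its nucleus, and the points of the line on no secant

module Construction {r : ℕ} {c ℓ₁ ℓ₂ : Level}
                    (F : GaloisField (suc (suc r) ℕ.^ 2) c ℓ₁ ℓ₂) where

  open FiniteField F
  open NormOne {r} F
  open Plane F
  open Uniqueness pointSetoid using (Unique)
  open SetoidReasoning setoid

  norm1⇒≉0 : ∀ {x} → Norm1 x → x ≉ 0#
  norm1⇒≉0 x∈N x≈0 = 1≉0 (trans (sym x∈N) (trans (*-congʳ x≈0) (zeroˡ _)))

  norm1-* : ∀ {x y} → Norm1 x → Norm1 y → Norm1 (x * y)
  norm1-* {x} {y} x∈N y∈N = begin
    (x * y) ^ suc q        ≈⟨ ^-distrib-* x y (suc q) ⟩
    x ^ suc q * y ^ suc q  ≈⟨ *-cong x∈N y∈N ⟩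
    1# * 1#                ≈⟨ *-identityˡ 1# ⟩
    1#                     ∎

  -- The point with parameter x of the conic X₀ X₁ = X₂², which meets ℓ∞ only in
  -- (1 , 0 , 0) and (0 , 1 , 0).
  conicPoint : Carrier → Point
  conicPoint x = triple (x * x) 1# x , 1F , ≉0⇒#0 1≉0

  -- In characteristic two all tangents of the conic pass through this point.
  nucleusPoint : Point
  nucleusPoint = triple 0# 0# 1# , 2F , ≉0⇒#0 1≉0

  -- The points of ℓ∞, apart from direction∞.  The sign makes direction w lie on
  -- the secants through conic points whose parameters have product w.
  direction : Carrier → Point
  direction w = triple (- w) 1# 0# , 1F , ≉0⇒#0 1≉0

  direction∞ : Point
  direction∞ = triple 1# 0# 0# , 0F , ≉0⇒#0 1≉0

  -- The points used off ℓ∞: the conic points with parameter of norm one and, in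
  -- characteristic two only, the nucleus.
  data Affine : Point → Set (c Level.⊔ ℓ₁) where
    conic   : ∀ {x} → Norm1 x → Affine (conicPoint x)
    nucleus : 1# + 1# ≈ 0# → Affine nucleusPoint

  -- The points of ℓ∞ different from (- u , 1 , 0) for all u of norm one.  A
  -- secant of the conic points meets ℓ∞ in such a point with u = x y, and in
  -- characteristic two the line from the nucleus to the conic point with
  -- parameter x meets ℓ∞ in the one with u = x².
  Direction : Point → Set (c Level.⊔ ℓ₁)
  Direction P = coords P 2F ≈ 0# ×
                (∀ u → Norm1 u → coords P 0F + u * coords P 1F ≉ 0#)

  affine⇒∉ℓ∞ : ∀ P → Affine P → coords P 2F ≉ 0#
  affine⇒∉ℓ∞ _ (conic x∈N)  = norm1⇒≉0 x∈N
  affine⇒∉ℓ∞ _ (nucleus _)  = 1≉0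

  conicPoint-cong : ∀ {x y} → x ≈ y → conicPoint x ∼ conicPoint y
  conicPoint-cong x≈y = 1# , ≉0⇒#0 1≉0 , λ where
    0F → trans (*-cong x≈y x≈y) (sym (*-identityˡ _))
    1F → sym (*-identityˡ _)
    2F → trans x≈y (sym (*-identityˡ _))

  conicPoint-injective : ∀ {x y} → conicPoint x ∼ conicPoint y → x ≈ y
  conicPoint-injective {x} {y} (a , _ , scaled) = begin
    x             ≈⟨ scaled 2F ⟩
    a * y         ≈⟨ *-congʳ (*-identityʳ a) ⟨
    a * 1# * y    ≈⟨ *-congʳ (scaled 1F) ⟨
    1# * y        ≈⟨ *-identityˡ y ⟩
    y             ∎

  nucleusPoint≁conicPoint : ∀ {x} → ¬ (nucleusPoint ∼ conicPoint x)
  nucleusPoint≁conicPoint (a , a#0 , scaled) =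
    #⇒≉ a#0 (trans (sym (*-identityʳ a)) (sym (scaled 1F)))

  direction-injective : ∀ {v w} → direction v ∼ direction w → v ≈ w
  direction-injective {v} {w} (a , _ , scaled) = begin
    v                     ≈⟨ -‿involutive v ⟨
    - - v                 ≈⟨ -‿cong (scaled 0F) ⟩
    - (a * - w)           ≈⟨ solve 2 (λ a w → :- (a :* (:- w)) := a :* con (+ 1) :* w) refl a w ⟩
    a * 1# * w            ≈⟨ *-congʳ (scaled 1F) ⟨
    1# * w                ≈⟨ *-identityˡ w ⟩
    w                     ∎

  direction∞≁direction : ∀ {w} → ¬ (direction∞ ∼ direction w)
  direction∞≁direction (a , a#0 , scaled) =
    #⇒≉ a#0 (trans (sym (*-identityʳ a)) (sym (scaled 1F)))

  direction-Direction : ∀ {w} → ¬ Norm1 w → Direction (direction w)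
  direction-Direction {w} w∉N = refl , λ u u∈N eq → w∉N (begin
    w ^ suc q   ≈⟨ ^-congˡ (suc q) (u≈w u eq) ⟨
    u ^ suc q   ≈⟨ u∈N ⟩
    1#          ∎)
    where
    u≈w : ∀ u → - w + u * 1# ≈ 0# → u ≈ w
    u≈w u eq = x-y≈0⇒x≈y (trans
      (solve 2 (λ u w → u :- w := :- w :+ u :* con (+ 1)) refl u w) eq)

  direction∞-Direction : Direction direction∞
  direction∞-Direction = refl , λ u _ eq →
    1≉0 (trans (solve 1 (λ u → con (+ 1) := con (+ 1) :+ u :* con (+ 0)) refl u) eq)

  -- Triples of affine points and directions

  -- The form in which the polynomial identities below are used: v is a
  -- coordinate, or 1 + 1, known to vanish.
  a≈u+vw⇒a≈0 : ∀ {a u v w} → a ≈ u + v * w → u ≈ 0# → v ≈ 0# → a ≈ 0#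
  a≈u+vw⇒a≈0 {a} {u} {v} {w} eq u≈0 v≈0 = begin
    a            ≈⟨ eq ⟩
    u + v * w    ≈⟨ +-cong u≈0 (trans (*-congʳ v≈0) (zeroˡ w)) ⟩
    0# + 0#      ≈⟨ +-identityʳ 0# ⟩
    0#           ∎

  distinct⇒difference≉0 : ∀ {x y} → ¬ (conicPoint x ∼ conicPoint y) → x - y ≉ 0#
  distinct⇒difference≉0 x≁y x-y≈0 = x≁y (conicPoint-cong (x-y≈0⇒x≈y x-y≈0))

  -- The Vandermonde determinant.
  conic-conic-conic : ∀ x y z → Distinct₃ (conicPoint x) (conicPoint y) (conicPoint z) →
                      Nondegenerate (conicPoint x) (conicPoint y) (conicPoint z)
  conic-conic-conic x y z (x≁y , x≁z , y≁z) det≈0 =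
    *-≉0 (*-≉0 (distinct⇒difference≉0 x≁y) (distinct⇒difference≉0 y≁z)) (distinct⇒difference≉0 x≁z)
      (begin
        (x - y) * (y - z) * (x - z)
          ≈⟨ solve 3 (λ x y z → (x :- y) :* (y :- z) :* (x :- z) :=
               :- (x :* x :* (con (+ 1) :* z :- y :* con (+ 1)) :+
                   con (+ 1) :* (y :* (z :* z) :- y :* y :* z) :+
                   x :* (y :* y :* con (+ 1) :- con (+ 1) :* (z :* z)))) refl x y z ⟩
        - det (coords (conicPoint x)) (coords (conicPoint y)) (coords (conicPoint z))
          ≈⟨ -‿cong det≈0 ⟩
        - 0#
          ≈⟨ -0#≈0# ⟩
        0# ∎)

  -- Since 2 = 0, the determinant x² - y² is the square of x - y.
  conic-conic-nucleus : ∀ x y → 1# + 1# ≈ 0# → ¬ (conicPoint x ∼ conicPoint y) →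
                        Nondegenerate (conicPoint x) (conicPoint y) nucleusPoint
  conic-conic-nucleus x y 2≈0 x≁y det≈0 =
    *-≉0 x-y≉0 x-y≉0 (a≈u+vw⇒a≈0
      (solve 2 (λ x y → (x :- y) :* (x :- y) :=
         x :* x :* (con (+ 1) :* con (+ 1) :- y :* con (+ 0)) :+
         con (+ 1) :* (y :* con (+ 0) :- y :* y :* con (+ 1)) :+
         x :* (y :* y :* con (+ 0) :- con (+ 1) :* con (+ 0)) :+
         (con (+ 1) :+ con (+ 1)) :* (y :* y :- x :* y)) refl x y)
      det≈0 2≈0)
    where x-y≉0 = distinct⇒difference≉0 x≁y

  three-affine : ∀ P Q R → Affine P → Affine Q → Affine R → Distinct₃ P Q R → Nondegenerate P Q R
  three-affine _ _ _ (conic {x} _) (conic {y} _) (conic {z} _) distinct =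
    conic-conic-conic x y z distinct
  three-affine _ _ _ (conic {x} _) (conic {y} _) (nucleus 2≈0) (x≁y , _) =
    conic-conic-nucleus x y 2≈0 x≁y
  three-affine P Q R (conic {x} _) (nucleus 2≈0) (conic {y} _) (_ , x≁y , _) =
    nondegenerate-rotate R P Q (conic-conic-nucleus y x 2≈0 (x≁y ∘ ∼-sym {R} {P}))
  three-affine P Q R (nucleus 2≈0) (conic {x} _) (conic {y} _) (_ , _ , x≁y) =
    nondegenerate-rotate R P Q (nondegenerate-rotate Q R P (conic-conic-nucleus x y 2≈0 x≁y))
  three-affine _ _ _ (nucleus _) (nucleus _) _ (P≁Q , _) =
    contradiction (∼-refl {nucleusPoint}) P≁Q
  three-affine _ _ _ (nucleus _) _ (nucleus _) (_ , P≁R , _) =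
    contradiction (∼-refl {nucleusPoint}) P≁R
  three-affine _ _ _ _ (nucleus _) (nucleus _) (_ , _ , Q≁R) =
    contradiction (∼-refl {nucleusPoint}) Q≁R

  -- For two conic points the determinant is (y - x) (r₀ + x y r₁); for the
  -- nucleus and one conic point it is, up to sign and a multiple of 2, r₀ + x² r₁.
  two-affine : ∀ P Q R → Affine P → Affine Q → Direction R → ¬ (P ∼ Q) → Nondegenerate P Q R
  two-affine _ _ R (conic {x} x∈N) (conic {y} y∈N) (r₂≈0 , R∉) x≁y det≈0 =
    *-≉0 (distinct⇒difference≉0 x≁y) (R∉ (x * y) (norm1-* x∈N y∈N))
      (trans (a≈u+vw⇒a≈0
        (solve 5 (λ x y r₀ r₁ r₂ → (x :- y) :* (r₀ :+ x :* y :* r₁) :=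
           con (+ 0) :- (x :* x :* (con (+ 1) :* r₂ :- y :* r₁) :+ con (+ 1) :* (y :* r₀ :- y :* y :* r₂) :+
           x :* (y :* y :* r₁ :- con (+ 1) :* r₀)) :+ r₂ :* (x :* x :- y :* y))
           refl x y (coords R 0F) (coords R 1F) (coords R 2F))
        (trans (+-congˡ (-‿cong det≈0)) (x-0≈x 0#)) r₂≈0) refl)
  two-affine _ _ R (conic {x} x∈N) (nucleus 2≈0) (_ , R∉) _ det≈0 =
    R∉ (x * x) (norm1-* x∈N x∈N) (a≈u+vw⇒a≈0
      (solve 4 (λ x r₀ r₁ r₂ → r₀ :+ x :* x :* r₁ :=
         x :* x :* (con (+ 0) :* r₂ :- con (+ 1) :* r₁) :+ con (+ 1) :* (con (+ 1) :* r₀ :- con (+ 0) :* r₂) :+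
         x :* (con (+ 0) :* r₁ :- con (+ 0) :* r₀) :+ (con (+ 1) :+ con (+ 1)) :* (x :* x :* r₁))
         refl x (coords R 0F) (coords R 1F) (coords R 2F))
      det≈0 2≈0)
  two-affine P Q R (nucleus 2≈0) (conic {y} y∈N) (_ , R∉) _ det≈0 =
    R∉ (y * y) (norm1-* y∈N y∈N) (a≈u+vw⇒a≈0
      (solve 4 (λ y r₀ r₁ r₂ → r₀ :+ y :* y :* r₁ :=
         con (+ 0) :* (con (+ 1) :* r₂ :- y :* r₁) :+ con (+ 0) :* (y :* r₀ :- y :* y :* r₂) :+
         con (+ 1) :* (y :* y :* r₁ :- con (+ 1) :* r₀) :+ (con (+ 1) :+ con (+ 1)) :* r₀)
         refl y (coords R 0F) (coords R 1F) (coords R 2F))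
      det≈0 2≈0)
  two-affine _ _ _ (nucleus _) (nucleus _) _ P≁Q =
    contradiction (∼-refl {nucleusPoint}) P≁Q

  -- The determinant is the product of p₂ and the minor of Q and R.
  one-affine : ∀ P Q R → Affine P → Direction Q → Direction R → ¬ (Q ∼ R) → Nondegenerate P Q R
  one-affine P Q R P-affine (q₂≈0 , _) (r₂≈0 , _) Q≁R det≈0 =
    *-≉0 (affine⇒∉ℓ∞ P P-affine)
      (distinct⇒minor≉0 Q R (∈ℓ∞⇐ Q q₂≈0) (∈ℓ∞⇐ R r₂≈0) Q≁R)
      (a≈u+vw⇒a≈0
        (solve 9 (λ p₀ p₁ p₂ q₀ q₁ q₂ r₀ r₁ r₂ → p₂ :* (q₀ :* r₁ :- q₁ :* r₀) :=
           p₀ :* (q₁ :* r₂ :- q₂ :* r₁) :+ p₁ :* (q₂ :* r₀ :- q₀ :* r₂) :+ p₂ :* (q₀ :* r₁ :- q₁ :* r₀) :+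
           q₂ :* (p₀ :* r₁ :- p₁ :* r₀) :+ r₂ :* (p₁ :* q₀ :- p₀ :* q₁))
           refl (coords P 0F) (coords P 1F) (coords P 2F) (coords Q 0F) (coords Q 1F) (coords Q 2F)
                (coords R 0F) (coords R 1F) (coords R 2F))
        (a≈u+vw⇒a≈0 refl det≈0 q₂≈0) r₂≈0)

  nondegenerate : ∀ P Q R → Affine P ⊎ Direction P → Affine Q ⊎ Direction Q →
                  Affine R ⊎ Direction R → Distinct₃ P Q R →
                  ¬ (Direction P × Direction Q × Direction R) → Nondegenerate P Q R
  nondegenerate P Q R (inj₁ p) (inj₁ q) (inj₁ r) distinct _ = three-affine P Q R p q r distinct
  nondegenerate P Q R (inj₁ p) (inj₁ q) (inj₂ r) (P≁Q , _) _ = two-affine P Q R p q r P≁Q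
  nondegenerate P Q R (inj₁ p) (inj₂ q) (inj₁ r) (_ , P≁R , _) _ =
    nondegenerate-rotate R P Q (two-affine R P Q r p q (P≁R ∘ ∼-sym {R} {P}))
  nondegenerate P Q R (inj₂ p) (inj₁ q) (inj₁ r) (_ , _ , Q≁R) _ =
    nondegenerate-rotate R P Q (nondegenerate-rotate Q R P (two-affine Q R P q r p Q≁R))
  nondegenerate P Q R (inj₁ p) (inj₂ q) (inj₂ r) (_ , _ , Q≁R) _ = one-affine P Q R p q r Q≁R
  nondegenerate P Q R (inj₂ p) (inj₁ q) (inj₂ r) (_ , P≁R , _) _ =
    nondegenerate-rotate R P Q (nondegenerate-rotate Q R P
      (one-affine Q R P q r p (P≁R ∘ ∼-sym {R} {P})))
  nondegenerate P Q R (inj₂ p) (inj₂ q) (inj₁ r) (P≁Q , _) _ =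
    nondegenerate-rotate R P Q (one-affine R P Q r p q P≁Q)
  nondegenerate P Q R (inj₂ p) (inj₂ q) (inj₂ r) _ ¬all = contradiction (p , q , r) ¬all

  -- Harcs of affine points and directions

  -- Any affine points and directions form a harc; the rest is counting.
  module _ {ps ds : List Point} (ps! : Unique ps) (ds! : Unique ds)
           (ps-affine : All Affine ps) (ds-direction : All Direction ds) where

    private
      K₁ = fromList ps ps!
      K₂ = fromList ds ds!

      affine : ∀ i → Affine (lookup ps i)
      affine i = All.lookup ps-affine (∈-lookup i)

      directional : ∀ i → Direction (lookup ds i)
      directional i = All.lookup ds-direction (∈-lookup i)

      representative : ∀ {P} → ⟦ K₁ ⟧ P ⊎ ⟦ K₂ ⟧ P → ∃[ P′ ] P′ ∼ P × (Affine P′ ⊎ Direction P′)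
      representative (inj₁ (i , eq)) = lookup ps i , eq , inj₁ (affine i)
      representative (inj₂ (i , eq)) = lookup ds i , eq , inj₂ (directional i)

      direction⇒∈ℓ∞ : ∀ {P P′} → P′ ∼ P → Direction P′ → P ∈ₗ ℓ∞
      direction⇒∈ℓ∞ {P} {P′} P′∼P (p₂≈0 , _) =
        ∈ℓ∞-resp {P} {P′} (∼-sym {P′} {P} P′∼P) (∈ℓ∞⇐ P′ p₂≈0)

      K-nondegenerate : ∀ P Q R → ⟦ K₁ ⟧ P ⊎ ⟦ K₂ ⟧ P → ⟦ K₁ ⟧ Q ⊎ ⟦ K₂ ⟧ Q →
                        ⟦ K₁ ⟧ R ⊎ ⟦ K₂ ⟧ R → Distinct₃ P Q R →
                        ¬ (P ∈ₗ ℓ∞ × Q ∈ₗ ℓ∞ × R ∈ₗ ℓ∞) → Nondegenerate P Q R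
      K-nondegenerate P Q R P∈K Q∈K R∈K (P≁Q , P≁R , Q≁R) ¬all
        with representative {P} P∈K | representative {Q} Q∈K | representative {R} R∈K
      ... | P′ , P′∼P , p | Q′ , Q′∼Q , q | R′ , R′∼R , r =
        nondegenerate-resp {P} {P′} {Q} {Q′} {R} {R′} P′∼P Q′∼Q R′∼R
          (nondegenerate P′ Q′ R′ p q r
            ( P≁Q ∘ transfer {P} {P′} {Q} {Q′} P′∼P Q′∼Q
            , P≁R ∘ transfer {P} {P′} {R} {R′} P′∼P R′∼R
            , Q≁R ∘ transfer {Q} {Q′} {R} {R′} Q′∼Q R′∼R)
            λ (p , q , r) → ¬all ( direction⇒∈ℓ∞ {P} {P′} P′∼P p
                                 , direction⇒∈ℓ∞ {Q} {Q′} Q′∼Q q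
                                 , direction⇒∈ℓ∞ {R} {R′} R′∼R r))
        where
        transfer : ∀ {A A′ B B′} → A′ ∼ A → B′ ∼ B → A′ ∼ B′ → A ∼ B
        transfer {A} {A′} {B} {B′} A′∼A B′∼B A′∼B′ =
          ∼-trans {A} {A′} {B} (∼-sym {A′} {A} A′∼A) (∼-trans {A′} {B′} {B} A′∼B′ B′∼B)

      K₁-off : ∀ P → ⟦ K₁ ⟧ P → ¬ (P ∈ₗ ℓ∞)
      K₁-off P (i , P′∼P) P∈ℓ∞ = affine⇒∉ℓ∞ P′ (affine i)
        (∈ℓ∞⇒ P′ (∈ℓ∞-resp {P′} {P} P′∼P P∈ℓ∞))
        where P′ = lookup ps i

      K₂-on : ∀ P → ⟦ K₂ ⟧ P → P ∈ₗ ℓ∞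
      K₂-on P (i , P′∼P) = direction⇒∈ℓ∞ {P} {lookup ds i} P′∼P (directional i)

    isHarc : IsHarc ℓ∞ K₁ K₂
    isHarc = record
      { K₁-off-Ψ = K₁-off
      ; K₂-on-Ψ  = K₂-on
      ; K₁-arc   = λ P Q R P∈ Q∈ R∈ distinct →
          det≉0⇒noncollinear P Q R
            (K-nondegenerate P Q R (inj₁ P∈) (inj₁ Q∈) (inj₁ R∈) distinct
              (λ (P∈ℓ∞ , _) → K₁-off P P∈ P∈ℓ∞))
      ; K₂-arc   = λ P Q P∈ Q∈ →
          distinct⇒independent P Q (K₂-on P P∈) (K₂-on Q Q∈)
      ; K-mixed  = λ P Q R P∈ Q∈ R∈ distinct ¬all →
          det≉0⇒independent (coords P) (coords Q) (coords R)
            (K-nondegenerate P Q R P∈ Q∈ R∈ distinct ¬all)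
      }

  conicPoints directions : List Point
  conicPoints = List.map conicPoint norm1s
  directions  = direction∞ ∷ List.map direction others

  conicPoints! : Unique conicPoints
  conicPoints! = UniqueProperties.map⁺ setoid pointSetoid conicPoint-injective norm1s!

  directions! : Unique directions
  directions! = All.map⁺ (All.tabulate (λ _ → direction∞≁direction)) ∷
    UniqueProperties.map⁺ setoid pointSetoid direction-injective others!

  conicPoints-affine : All Affine conicPoints
  conicPoints-affine = All.map⁺ (All.map conic all-norm1)

  directions-direction : All Direction directions
  directions-direction = direction∞-Direction ∷ All.map⁺ (All.map direction-Direction all-other)

  |conicPoints| : length conicPoints ≡ q ℕ.+ 1
  |conicPoints| = ≡.trans (List.length-map conicPoint norm1s)
    (≡.trans |norm1s| (ℕ.+-comm 1 q))

  |nucleus∷conicPoints| : suc (length conicPoints) ≡ q ℕ.+ 2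
  |nucleus∷conicPoints| = ≡.trans (≡.cong suc |conicPoints|) (≡.sym (ℕ.+-suc q 1))

  |directions| : length directions ≡ q ℕ.^ 2 ℕ.∸ q
  |directions| = ≡.trans
    (≡.cong suc (≡.trans (List.length-map direction others) |others|))
    (≡.sym (≡.trans (≡.cong (ℕ._∸ q) q²≡q+[2+r[q+1]]) (ℕ.m+n∸m≡n q _)))
    where
    q²≡q+[2+r[q+1]] : q ℕ.^ 2 ≡ q ℕ.+ suc (suc (r ℕ.* suc q))
    q²≡q+[2+r[q+1]] = expand r
      where
      expand : ∀ r → (2 ℕ.+ r) ℕ.* ((2 ℕ.+ r) ℕ.* 1) ≡ (2 ℕ.+ r) ℕ.+ (2 ℕ.+ r ℕ.* (3 ℕ.+ r))
      expand = ℕ-Ring.solve-∀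

  harc : HasHarc (q ℕ.+ 1) (q ℕ.^ 2 ℕ.∸ q)
  harc = ≡.subst₂ HasHarc |conicPoints| |directions|
    (ℓ∞ , fromList _ conicPoints! , fromList _ directions! ,
     isHarc conicPoints! directions! conicPoints-affine directions-direction)

  maximalHarc : 2 ∣ q → HasMaximalHarc (q ℕ.+ 2) (q ℕ.^ 2 ℕ.∸ q)
  maximalHarc 2∣q = ≡.subst₂ HasMaximalHarc |nucleus∷conicPoints| |directions|
    (ℓ∞ , fromList _ points! , fromList _ directions! ,
     isHarc points! directions! (nucleus (even⇒1+1≈0 2∣q) ∷ conicPoints-affine) directions-direction ,
     total)
    where
    points! : Unique (nucleusPoint ∷ conicPoints)
    points! = All.map⁺ (All.tabulate (λ _ → nucleusPoint≁conicPoint)) ∷ conicPoints!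

    total : suc (length conicPoints) ℕ.+ length directions ≡ q ℕ.^ 2 ℕ.+ 2
    total = ≡.trans (≡.cong₂ ℕ._+_ |nucleus∷conicPoints| |directions|) ([q+2]+[q²∸q]≡q²+2 q)

primePower≥2 : ∀ {q} → IsPrimePower q → 2 ℕ.≤ q
primePower≥2 (p , e , p-prime , 1≤e , ≡.refl) = begin
  2         ≤⟨ nonTrivial⇒n>1 p {{prime⇒nonTrivial p-prime}} ⟩
  p         ≡⟨ ℕ.^-identityʳ p ⟨
  p ℕ.^ 1   ≤⟨ ℕ.^-monoʳ-≤ p {{prime⇒nonZero p-prime}} 1≤e ⟩
  p ℕ.^ e   ∎
  where open ℕ.≤-Reasoning

open import Data.Nat.Base using (_+_; _∸_; _^_)

theorem5p4 : ∀ {c ℓ₁ ℓ₂ : Level} (q : ℕ) → IsPrimePower q →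
    (F : GaloisField (q ^ 2) c ℓ₁ ℓ₂) →
    (¬ (2 ∣ q) → ProjectivePlane.HasHarc F (q + 1) (q ^ 2 ∸ q)) ×
    (2 ∣ q → ProjectivePlane.HasMaximalHarc F (q + 2) (q ^ 2 ∸ q))
theorem5p4 q q-primePower F with primePower≥2 q-primePower
theorem5p4 (suc (suc r)) _ F | s≤s (s≤s z≤n) = (λ _ → harc) , maximalHarc
  where open Construction {r} F
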